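{- Let $G$ be a finite graph and let $e$ and $f$ be distinct edges of $G$. In the acyclic subgraph toggle group $T(\mathcal{AS}(G))$, $(t_et_f)^2=1$ if and only if no cycle of $G$ contains both $e$ and $f$.
   Context: An acyclic subgraph of a graph $G$ is a collection of edges in $E(G)$ in which there is no cycle; $\mathcal{AS}(G)\subseteq 2^{E(G)}$ is the set of acyclic subgraphs, with ground set the edge set $E(G)$. For $e\in E(G)$ the toggle $t_e:\mathcal{AS}(G)\to\mathcal{AS}(G)$ is given by $t_e(X)=X\cup\{e\}$ if $e\notin X$ and $X\cup\{e\}\in\mathcal{AS}(G)$; $t_e(X)=X\setminus\{e\}$ if $e\in X$ and $X\setminus\{e\}\in\mathcal{AS}(G)$; and $t_e(X)=X$ otherwise. $T(\mathcal{AS}(G))$ is the subgroup of the symmetric group on $\mathcal{AS}(G)$ generated by all $t_e$, $e\in E(G)$. -}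

module Defs where

open import Level using (Level; _⊔_; 0ℓ)
open import Algebra.Bundles using (Group)
open import Data.Fin.Base using (Fin; zero; suc; toℕ)
open import Data.Fin.Properties using (any?; all?; injective⇒≤)
  renaming (_≟_ to _≟ᶠ_)
open import Data.Fin.Subset using (Subset; _∈_; _∉_; _∪_; _-_; ⁅_⁆)
open import Data.Fin.Subset.Properties
  using (_∈?_; ⊆-antisym; x∈⁅x⁆; x∈⁅y⁆⇒x≡y; x∈p∪q⁻; x∈p∪q⁺; p─q⊆p;
         x∈p∧x≢y⇒x∈p-y)
open import Data.Irrelevant using ([_])
open import Data.Nat.Base using (ℕ; zero; suc; _<_)
open import Data.Nat.DivMod using (_mod_)
open import Data.Nat.Properties using (anyUpTo?)
open import Data.Product using (_×_; _,_; Σ-syntax; ∃; ∃-syntax; proj₁; proj₂)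
open import Data.Product.Properties using (≡-dec)
open import Data.Refinement using (Refinement-syntax; _,_)
open import Data.Refinement.Properties using (value-injective)
open import Data.Sum using (_⊎_; inj₁; inj₂; [_,_]′)
open import Data.Vec.Base using (_∷_; there)
import Data.Vec.Functional as F
open import Function.Base using (_∘_)
open import Function.Bundles using (_↔_; Inverse; mk↔ₛ′)
open import Function.Construct.Composition using (_↔-∘_)
open import Function.Construct.Identity using (↔-id)
open import Function.Construct.Symmetry using (↔-sym)
open import Function.Definitions using (Injective)
open import Relation.Binary.PropositionalEquality
open import Relation.Nullary using (¬_; Dec; yes; no; contradiction)
open import Relation.Nullary.Negation.Core using (contradiction-irr)
open import Relation.Nullary.Decidable using (map′; ¬?; _×-dec_; _⊎-dec_)

------------------------------------------------------------------------
-- Finite graphs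

-- Loops and parallel edges are allowed.  The order of the two ends of an
-- edge carries no meaning: edges are only inspected through `Joins`.

record Graph : Set where
  field
    #vertices : ℕ
    #edges    : ℕ
    ends      : Fin #edges → Fin #vertices × Fin #vertices

  Vertex : Set
  Vertex = Fin #vertices

  Edge : Set
  Edge = Fin #edges

  Joins : Edge → Vertex → Vertex → Set
  Joins e u v = ends e ≡ (u , v) ⊎ ends e ≡ (v , u)

open Graph public using (Vertex; Edge)

next : ∀ {k} → Fin (suc k) → Fin (suc k)
next {k} i = suc (toℕ i) mod suc k

module _ (G : Graph) where

  open Graph G using (Joins)

  -- A cycle of length `suc k`: distinct vertices v₀,…,vₖ and distinct edges
  -- e₀,…,eₖ with eᵢ joining vᵢ to vᵢ₊₁, indices modulo `suc k`.  A loop is a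
  -- cycle of length 1 and two parallel edges form a cycle of length 2; in a
  -- simple graph every cycle has length at least 3.

  record Cycle : Set where
    field
      k               : ℕ
      vertex          : Fin (suc k) → Vertex G
      edge            : Fin (suc k) → Edge G
      vertex-distinct : Injective _≡_ _≡_ vertex
      edge-distinct   : Injective _≡_ _≡_ edge
      joins           : ∀ i → Joins (edge i) (vertex i) (vertex (next i))

infix 4 _∈ᶜ_

_∈ᶜ_ : ∀ {G} → Edge G → Cycle G → Set
e ∈ᶜ C = ∃[ i ] Cycle.edge C i ≡ e

module _ (G : Graph) where

  open Graph G using (#edges)

  Acyclic : Subset #edges → Set
  Acyclic X = ¬ (Σ[ C ∈ Cycle G ] (∀ e → e ∈ᶜ C → e ∈ X))

  -- Acyclicity proofs are irrelevant, so acyclic subgraphs are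
  -- propositionally equal exactly when their edge sets are.

  AcyclicSubgraph : Set
  AcyclicSubgraph = [ X ∈ Subset #edges ∣ Acyclic X ]

------------------------------------------------------------------------
-- Decidability of acyclicity

private
  anyFun? : ∀ {n} k {P : (Fin k → Fin n) → Set} →
            (∀ {f g} → f ≗ g → P f → P g) →
            (∀ f → Dec (P f)) → Dec (∃ P)
  anyFun? zero resp P? =
    map′ (F.[] ,_) (λ (f , p) → resp (λ ()) p) (P? F.[])
  anyFun? (suc k) {P} resp P? =
    map′ (λ (x , f , p) → x F.∷ f , p)
         (λ (f , p) → f zero , f ∘ suc , resp (uncons f) p)
         (any? λ x → anyFun? k (λ eq → resp (cons x eq)) (λ f → P? (x F.∷ f)))
    where
    uncons : ∀ f → f ≗ (f zero F.∷ (f ∘ suc))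
    uncons f zero    = refl
    uncons f (suc i) = refl
    cons : ∀ x {f g} → f ≗ g → (x F.∷ f) ≗ (x F.∷ g)
    cons x eq zero    = refl
    cons x eq (suc i) = eq i

  injective? : ∀ {k n} (f : Fin k → Fin n) → Dec (Injective _≡_ _≡_ f)
  injective? f =
    map′ (λ h {i} {j} eq → [ (λ ne → contradiction eq ne) , (λ p → p) ]′ (h i j))
         (λ h i j → split h i j)
         (all? λ i → all? λ j → ¬? (f i ≟ᶠ f j) ⊎-dec (i ≟ᶠ j))
    where
    split : Injective _≡_ _≡_ f → ∀ i j → f i ≢ f j ⊎ i ≡ j
    split h i j with f i ≟ᶠ f j
    ... | yes eq = inj₂ (h eq)
    ... | no  ne = inj₁ ne

module _ (G : Graph) where

  open Graph G using (#edges; ends; Joins)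

  private
    joins? : ∀ e u v → Dec (Joins e u v)
    joins? e u v = (ends e ≟ᵖ (u , v)) ⊎-dec (ends e ≟ᵖ (v , u))
      where _≟ᵖ_ = ≡-dec _≟ᶠ_ _≟ᶠ_

    CycleIn : Subset #edges → ∀ k →
              (Fin (suc k) → Vertex G) → (Fin (suc k) → Edge G) → Set
    CycleIn X k v ε =
      Injective _≡_ _≡_ v × Injective _≡_ _≡_ ε ×
      (∀ i → Joins (ε i) (v i) (v (next i))) × (∀ i → ε i ∈ X)

    cycleIn? : ∀ X k v ε → Dec (CycleIn X k v ε)
    cycleIn? X k v ε =
      injective? v ×-dec injective? ε ×-dec
      all? (λ i → joins? (ε i) (v i) (v (next i))) ×-dec
      all? (λ i → ε i ∈? X)

    cycleIn-resp : ∀ {X k v v′ ε ε′} → v ≗ v′ → ε ≗ ε′ →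
                   CycleIn X k v ε → CycleIn X k v′ ε′
    cycleIn-resp {X} {v = v} {v′} {ε} {ε′} p q (vi , ei , js , ins) =
      (λ {i} {j} eq → vi (trans (p i) (trans eq (sym (p j))))) ,
      (λ {i} {j} eq → ei (trans (q i) (trans eq (sym (q j))))) ,
      (λ i → subst (λ a → Joins a (v′ i) (v′ (next i))) (q i)
               (subst₂ (Joins (ε i)) (p i) (p (next i)) (js i))) ,
      (λ i → subst (_∈ X) (q i) (ins i))

  -- Opaque so that case splits on it never unfold the search.
  opaque
    acyclic? : ∀ X → Dec (Acyclic G X)
    acyclic? X = ¬? (map′ to from search)
      where
      -- The edges of a cycle are distinct, so its length is at most #edges.
      search : Dec (∃[ k ] k < #edges × ∃[ v ] ∃[ ε ] CycleIn X k v ε)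
      search = anyUpTo?
        (λ k → anyFun? (suc k)
          (λ p (ε , c) → ε , cycleIn-resp p (λ _ → refl) c)
          (λ v → anyFun? (suc k) (cycleIn-resp (λ _ → refl)) (cycleIn? X k v)))
        #edges

      to : (∃[ k ] k < #edges × ∃[ v ] ∃[ ε ] CycleIn X k v ε) →
           Σ[ C ∈ Cycle G ] (∀ e → e ∈ᶜ C → e ∈ X)
      to (k , _ , v , ε , vi , ei , js , ins) =
        record { k = k ; vertex = v ; edge = ε ; vertex-distinct = vi
               ; edge-distinct = ei ; joins = js } ,
        λ { _ (i , refl) → ins i }

      from : (Σ[ C ∈ Cycle G ] (∀ e → e ∈ᶜ C → e ∈ X)) →
             ∃[ k ] k < #edges × ∃[ v ] ∃[ ε ] CycleIn X k v ε
      from (C , ins) =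
        k , injective⇒≤ edge-distinct , vertex , edge ,
        vertex-distinct , edge-distinct , joins , λ i → ins _ (i , refl)
        where open Cycle C

------------------------------------------------------------------------
-- Toggles

  toggle : Edge G → AcyclicSubgraph G → AcyclicSubgraph G
  toggle e (X , p) with e ∈? X
  toggle e (X , p) | no  e∉X with acyclic? (X ∪ ⁅ e ⁆)
  ... | yes a = X ∪ ⁅ e ⁆ , [ a ]
  ... | no  _ = X , p
  toggle e (X , p) | yes e∈X with acyclic? (X - e)
  ... | yes a = X - e , [ a ]
  ... | no  _ = X , p

private
  x∉p-x : ∀ {n} (p : Subset n) x → x ∉ p - x
  x∉p-x (_ ∷ p) (suc x) (there q) = x∉p-x p x q

  remove-add : ∀ {n} (X : Subset n) e → e ∉ X → (X ∪ ⁅ e ⁆) - e ≡ X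
  remove-add X e e∉X = ⊆-antisym
    (λ {x} q → [ (λ x∈X → x∈X)
               , (λ x∈e → contradiction
                   (subst (_∈ (X ∪ ⁅ e ⁆) - e) (x∈⁅y⁆⇒x≡y e x∈e) q)
                   (x∉p-x (X ∪ ⁅ e ⁆) e)) ]′
               (x∈p∪q⁻ X ⁅ e ⁆ (p─q⊆p (X ∪ ⁅ e ⁆) ⁅ e ⁆ q)))
    (λ x∈X → x∈p∧x≢y⇒x∈p-y (x∈p∪q⁺ (inj₁ x∈X)) (λ { refl → e∉X x∈X }))

  add-remove : ∀ {n} (X : Subset n) e → e ∈ X → (X - e) ∪ ⁅ e ⁆ ≡ X
  add-remove X e e∈X = ⊆-antisym
    (λ q → [ p─q⊆p X ⁅ e ⁆
           , (λ x∈e → subst (_∈ X) (sym (x∈⁅y⁆⇒x≡y e x∈e)) e∈X) ]′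
           (x∈p∪q⁻ (X - e) ⁅ e ⁆ q))
    back
    where
    back : ∀ {x} → x ∈ X → x ∈ (X - e) ∪ ⁅ e ⁆
    back {x} x∈X with x ≟ᶠ e
    ... | yes refl = x∈p∪q⁺ (inj₂ (x∈⁅x⁆ e))
    ... | no  x≢e  = x∈p∪q⁺ (inj₁ (x∈p∧x≢y⇒x∈p-y x∈X x≢e))

module _ (G : Graph) where

  open Graph G using (#edges)

  private
    remove-branch : ∀ e X → e ∈ X → .(a : Acyclic G X) (Y : Subset #edges)
                    .(b : Acyclic G Y) → X - e ≡ Y →
                    toggle G e (X , [ a ]) ≡ (Y , [ b ])
    remove-branch e X e∈X a Y b eq with e ∈? X
    ... | no  e∉X = contradiction e∈X e∉X
    ... | yes _ with acyclic? G (X - e)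
    ...   | yes _  = value-injective eq
    ...   | no  na = contradiction-irr (subst (Acyclic G) (sym eq) b) na

    add-branch : ∀ e X → e ∉ X → .(a : Acyclic G X) (Y : Subset #edges)
                 .(b : Acyclic G Y) → X ∪ ⁅ e ⁆ ≡ Y →
                 toggle G e (X , [ a ]) ≡ (Y , [ b ])
    add-branch e X e∉X a Y b eq with e ∈? X
    ... | yes e∈X = contradiction e∈X e∉X
    ... | no  _ with acyclic? G (X ∪ ⁅ e ⁆)
    ...   | yes _  = value-injective eq
    ...   | no  na = contradiction-irr (subst (Acyclic G) (sym eq) b) na

  toggle-involutive : ∀ e X → toggle G e (toggle G e X) ≡ X
  toggle-involutive e (X , [ p ]) with e ∈? X in eq₁
  toggle-involutive e (X , [ p ]) | no e∉X with acyclic? G (X ∪ ⁅ e ⁆) in eq₂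
  ... | yes a = remove-branch e (X ∪ ⁅ e ⁆) (x∈p∪q⁺ (inj₂ (x∈⁅x⁆ e))) a
                  X p (remove-add X e e∉X)
  ... | no  _ rewrite eq₁ | eq₂ = refl
  toggle-involutive e (X , [ p ]) | yes e∈X with acyclic? G (X - e) in eq₂
  ... | yes a = add-branch e (X - e) (x∉p-x X e) a X p (add-remove X e e∈X)
  ... | no  _ rewrite eq₁ | eq₂ = refl

------------------------------------------------------------------------
-- Symmetric groups and generated subgroups

-- The product is composition of functions: f ∙ g applies g first.

SymmetricGroup : ∀ {a} → Set a → Group a a
SymmetricGroup A = record
  { Carrier = A ↔ A
  ; _≈_     = λ f g → to f ≗ to g
  ; _∙_     = λ f g → f ↔-∘ g
  ; ε       = ↔-id A
  ; _⁻¹     = ↔-sym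
  ; isGroup = record
    { isMonoid = record
      { isSemigroup = record
        { isMagma = record
          { isEquivalence = record
            { refl  = λ _ → refl
            ; sym   = λ p x → sym (p x)
            ; trans = λ p q x → trans (p x) (q x)
            }
          ; ∙-cong = λ {f} {f′} {g} {g′} p q x →
              trans (cong (to f) (q x)) (p (to g′ x))
          }
        ; assoc = λ _ _ _ _ → refl
        }
      ; identity = (λ _ _ → refl) , (λ _ _ → refl)
      }
    ; inverse = (λ f → strictlyInverseʳ f) , (λ f → strictlyInverseˡ f)
    ; ⁻¹-cong = λ {f} {g} p x →
        trans (cong (from f)
                (trans (sym (strictlyInverseˡ g x)) (sym (p (from g x)))))
              (strictlyInverseʳ f (from g x))
    }
  }
  where open Inverse

module _ {c ℓ i} (𝔾 : Group c ℓ) {I : Set i} (gen : I → Group.Carrier 𝔾) where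

  open Group 𝔾

  data Generated : Carrier → Set (c ⊔ ℓ ⊔ i) where
    generator : ∀ j → Generated (gen j)
    identity′ : Generated ε
    product   : ∀ {x y} → Generated x → Generated y → Generated (x ∙ y)
    inverse′  : ∀ {x} → Generated x → Generated (x ⁻¹)
    respects  : ∀ {x y} → x ≈ y → Generated x → Generated y

  GeneratedSubgroup : Group (c ⊔ ℓ ⊔ i) ℓ
  GeneratedSubgroup = record
    { Carrier = ∃ Generated
    ; _≈_     = λ x y → proj₁ x ≈ proj₁ y
    ; _∙_     = λ (x , p) (y , q) → x ∙ y , product p q
    ; ε       = ε , identity′
    ; _⁻¹     = λ (x , p) → x ⁻¹ , inverse′ p
    ; isGroup = record
      { isMonoid = record
        { isSemigroup = record
          { isMagma = record
            { isEquivalence = record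
              { refl = Group.refl 𝔾 ; sym = Group.sym 𝔾 ; trans = Group.trans 𝔾 }
            ; ∙-cong = ∙-cong
            }
          ; assoc = λ _ _ _ → assoc _ _ _
          }
        ; identity = (λ _ → identityˡ _) , (λ _ → identityʳ _)
        }
      ; inverse = (λ _ → inverseˡ _) , (λ _ → inverseʳ _)
      ; ⁻¹-cong = ⁻¹-cong
      }
    }

------------------------------------------------------------------------
-- The acyclic subgraph toggle group

module _ (G : Graph) where

  togglePermutation : Edge G → AcyclicSubgraph G ↔ AcyclicSubgraph G
  togglePermutation e =
    mk↔ₛ′ (toggle G e) (toggle G e) (toggle-involutive G e) (toggle-involutive G e)

  ToggleGroup : Group 0ℓ 0ℓ
  ToggleGroup =
    GeneratedSubgroup (SymmetricGroup (AcyclicSubgraph G)) togglePermutation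

  t : Edge G → Group.Carrier ToggleGroup
  t e = togglePermutation e , generator e

{-# OPTIONS --safe #-}
module Submission where

-- Since toggles are involutions, (t_e t_f)² = 1 says that t_e and t_f
-- commute.  If no cycle contains both edges, whether e may be added to an
-- acyclic X does not depend on whether f ∈ X, so t_e and t_f commute.  If a
-- cycle C contains both, let X = C ∖ {e, f}: both X ∪ {e} and X ∪ {f} are
-- acyclic, so e lies in t_f (t_e X) but not in t_e (t_f X), because
-- X ∪ {e, f} = C.  Acyclicity holds because a cycle D with edges in C
-- contains every edge of C: walking along C, whenever D uses an edge of C it
-- leaves the far end of that edge through another edge, necessarily the next
-- edge of C.

open import Defs
open import Algebra.Bundles using (Group)
open import Data.Bool.Base using (true)
open import Data.Empty using (⊥-elim-irr)
open import Data.Fin.Base using (Fin; zero; suc; toℕ; fromℕ; inject₁)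
open import Data.Fin.Induction using (<-weakInduction; <-weakInduction-startingFrom)
open import Data.Fin.Properties
  using (_≟_; any?; toℕ-injective; toℕ-fromℕ<; toℕ-fromℕ; toℕ-inject₁; toℕ<n; ≤fromℕ)
open import Data.Fin.Relation.Unary.Top using (view; ‵fromℕ; ‵inject₁)
open import Data.Fin.Subset using (Subset; _∈_; _∉_; _⊆_; _∪_; _-_; ⁅_⁆)
open import Data.Fin.Subset.Properties
  using (_∈?_; ⊆-antisym; x∈⁅x⁆; x∈⁅y⁆⇒x≡y; x∈p∪q⁻; x∈p∪q⁺; p─q⊆p; x∈p∧x≢y⇒x∈p-y)
open import Data.Irrelevant using ([_])
open import Data.Nat.Base using (suc; s≤s)
open import Data.Nat.DivMod using (_%_; m%n<n; m<n⇒m%n≡m; n%n≡0)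
open import Data.Product using (_×_; _,_; Σ-syntax; ∃-syntax; proj₁; proj₂)
open import Data.Refinement using (value; _,_)
open import Data.Refinement.Properties using (value-injective)
open import Data.Sum using (_⊎_; inj₁; inj₂)
open import Data.Vec.Base using (_∷_; there; tabulate)
open import Data.Vec.Properties using (lookup⇒[]=; []=⇒lookup; lookup∘tabulate)
open import Function.Base using (_∘_)
open import Function.Bundles using (_⇔_; mk⇔; Equivalence)
open import Level using (0ℓ)
open import Relation.Binary.PropositionalEquality
  using (_≡_; _≢_; refl; sym; trans; cong; subst; module ≡-Reasoning)
open import Relation.Nullary using (¬_; Dec; yes; no; does; contradiction)
open import Relation.Nullary.Decidable using (¬?; _×-dec_; dec-true)
open import Relation.Unary using (Pred; Decidable)

open Equivalence using (to; from)

-- Membership in finite subsets.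

module _ {n} {P : Pred (Fin n) 0ℓ} (P? : Decidable P) where

  comprehension : Subset n
  comprehension = tabulate (does ∘ P?)

  ∈-comprehension : ∀ {x} → x ∈ comprehension ⇔ P x
  ∈-comprehension {x} = mk⇔
    (λ x∈ → sound (trans (sym (lookup∘tabulate (does ∘ P?) x)) ([]=⇒lookup x∈)))
    (λ px → lookup⇒[]= x _ (trans (lookup∘tabulate (does ∘ P?) x) (dec-true (P? x) px)))
    where
    sound : does (P? x) ≡ true → P x
    sound eq with yes px ← P? x = px

x∉p-x : ∀ {n} (p : Subset n) x → x ∉ p - x
x∉p-x (_ ∷ p) (suc x) (there q) = x∉p-x p x q

x∈p∪⁅y⁆⁻ : ∀ {n} (p : Subset n) {x y} → x ∈ p ∪ ⁅ y ⁆ → x ∈ p ⊎ x ≡ y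
x∈p∪⁅y⁆⁻ p {y = y} q with x∈p∪q⁻ p ⁅ y ⁆ q
... | inj₁ x∈p = inj₁ x∈p
... | inj₂ x∈y = inj₂ (x∈⁅y⁆⇒x≡y y x∈y)

x∈p∪⁅x⁆ : ∀ {n} {p : Subset n} {x} → x ∈ p ∪ ⁅ x ⁆
x∈p∪⁅x⁆ {x = x} = x∈p∪q⁺ (inj₂ (x∈⁅x⁆ x))

⊆-pointwise-antisym : ∀ {n} {p q : Subset n} → (∀ x → x ∈ p ⇔ x ∈ q) → p ≡ q
⊆-pointwise-antisym h = ⊆-antisym (λ {x} → to (h x)) (λ {x} → from (h x))

-- Cyclic indices.

next-inject₁ : ∀ {k} (i : Fin k) → next (inject₁ i) ≡ suc i
next-inject₁ {k} i = toℕ-injective (begin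
  toℕ (next (inject₁ i))         ≡⟨ toℕ-fromℕ< (m%n<n (suc (toℕ (inject₁ i))) (suc k)) ⟩
  suc (toℕ (inject₁ i)) % suc k  ≡⟨ cong (λ m → suc m % suc k) (toℕ-inject₁ i) ⟩
  suc (toℕ i) % suc k            ≡⟨ m<n⇒m%n≡m (s≤s (toℕ<n i)) ⟩
  suc (toℕ i)                    ∎)
  where open ≡-Reasoning

next-fromℕ : ∀ k → next (fromℕ k) ≡ zero
next-fromℕ k = toℕ-injective (begin
  toℕ (next (fromℕ k))         ≡⟨ toℕ-fromℕ< (m%n<n (suc (toℕ (fromℕ k))) (suc k)) ⟩
  suc (toℕ (fromℕ k)) % suc k  ≡⟨ cong (λ m → suc m % suc k) (toℕ-fromℕ k) ⟩
  suc k % suc k                ≡⟨ n%n≡0 (suc k) ⟩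
  0                            ∎)
  where open ≡-Reasoning

-- Inverse of `next`: it makes `next` injective and indexes the edge of a cycle that enters a given
-- vertex.
prev : ∀ {k} → Fin (suc k) → Fin (suc k)
prev {k} zero = fromℕ k
prev (suc i)  = inject₁ i

next-prev : ∀ {k} (i : Fin (suc k)) → next (prev i) ≡ i
next-prev {k} zero = next-fromℕ k
next-prev (suc i)  = next-inject₁ i

prev-next : ∀ {k} (i : Fin (suc k)) → prev (next i) ≡ i
prev-next {k} i with view i
... | ‵fromℕ     = cong prev (next-fromℕ k)
... | ‵inject₁ j = cong prev (next-inject₁ j)

next-injective : ∀ {k} {i j : Fin (suc k)} → next i ≡ next j → i ≡ j
next-injective {i = i} {j} eq =
  trans (sym (prev-next i)) (trans (cong prev eq) (prev-next j))

-- From `i` the property climbs to the last index, wraps around to `zero`, and from there climbs to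
-- every index.
next-induction : ∀ {k} (P : Pred (Fin (suc k)) 0ℓ) → (∀ i → P i → P (next i)) →
                 ∀ {i} → P i → ∀ j → P j
next-induction {k} P step {i} pᵢ = <-weakInduction P p₀ up
  where
  up : ∀ j → P (inject₁ j) → P (suc j)
  up j = subst P (next-inject₁ j) ∘ step (inject₁ j)
  p₀ : P zero
  p₀ = subst P (next-fromℕ k)
         (step (fromℕ k) (<-weakInduction-startingFrom P pᵢ up (≤fromℕ i)))

-- Cycles and the edges they use.

module _ {G : Graph} where

  open Graph G using (#edges; Joins)

  Joins-sym : ∀ {e u v} → Joins e u v → Joins e v u
  Joins-sym (inj₁ p) = inj₂ p
  Joins-sym (inj₂ p) = inj₁ p

  Joins-unique : ∀ {e u v x y} → Joins e u v → Joins e x y →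
                 (u ≡ x × v ≡ y) ⊎ (u ≡ y × v ≡ x)
  Joins-unique (inj₁ p) (inj₁ q) with refl ← trans (sym p) q = inj₁ (refl , refl)
  Joins-unique (inj₁ p) (inj₂ q) with refl ← trans (sym p) q = inj₂ (refl , refl)
  Joins-unique (inj₂ p) (inj₁ q) with refl ← trans (sym p) q = inj₂ (refl , refl)
  Joins-unique (inj₂ p) (inj₂ q) with refl ← trans (sym p) q = inj₁ (refl , refl)

  _∈ᶜ?_ : ∀ e (C : Cycle G) → Dec (e ∈ᶜ C)
  e ∈ᶜ? C = any? (λ i → Cycle.edge C i ≟ e)

  -- If `a` is edge `j` of `D`, then `u` is one of its ends, and the neighbouring edge of `D` there
  -- has index `prev j` or `next j`. That index is `j` itself only on a cycle of length 1, where `a`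
  -- is a loop; hence the alternative `u ≡ v`.
  cycle-leaves-vertex : ∀ (D : Cycle G) {a u v} → a ∈ᶜ D → Joins a u v →
    u ≡ v ⊎ ∃[ b ] ∃[ z ] (b ∈ᶜ D × b ≢ a × Joins b u z)
  cycle-leaves-vertex D (j , refl) a-joins
    with Joins-unique a-joins (Cycle.joins D j) | prev j ≟ j | next j ≟ j
  ... | inj₁ (refl , refl) | yes eq | _ =
        inj₁ (cong (Cycle.vertex D) (trans (sym (next-prev j)) (cong next eq)))
  ... | inj₁ (refl , refl) | no neq | _ = inj₂
        ( _ , _ , (prev j , refl) , neq ∘ Cycle.edge-distinct D
        , Joins-sym (subst (λ i → Joins (edge (prev j)) (vertex (prev j)) (vertex i))
                      (next-prev j) (joins (prev j))))
        where open Cycle D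
  ... | inj₂ (refl , refl) | _ | yes eq = inj₁ (cong (Cycle.vertex D) eq)
  ... | inj₂ (refl , refl) | _ | no neq = inj₂
        (_ , _ , (next j , refl) , neq ∘ Cycle.edge-distinct D , Cycle.joins D (next j))

  cycle-⊆⇒⊇ : ∀ (C D : Cycle G) → (∀ {e} → e ∈ᶜ D → e ∈ᶜ C) →
              ∀ {e} → e ∈ᶜ C → e ∈ᶜ D
  cycle-⊆⇒⊇ C D D⊆C (i , refl) =
    next-induction (λ i → edge i ∈ᶜ D) step start i
    where
    open Cycle C

    -- The edge of `D` at index `zero` always exists; `D⊆C` gives its place on `C`.
    start : edge (proj₁ (D⊆C (zero , refl))) ∈ᶜ D
    start = zero , sym (proj₂ (D⊆C (zero , refl)))

    step : ∀ i → edge i ∈ᶜ D → edge (next i) ∈ᶜ D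
    step i i∈D with cycle-leaves-vertex D i∈D (Joins-sym (joins i))
    -- Here `next i ≡ i`, so there is nothing new to reach.
    ... | inj₁ loop =
          subst (λ j → edge j ∈ᶜ D) (sym (vertex-distinct loop)) i∈D
    ... | inj₂ (b , z , b∈D , b≢eᵢ , b-joins) with D⊆C b∈D
    ...   | i′ , refl with Joins-unique b-joins (joins i′)
    -- Edge `i′` of `C` either starts at `vertex (next i)`, so `i′ ≡ next i`, or ends there, so
    -- `i′ ≡ i`, which `b≢eᵢ` excludes.
    ...     | inj₁ (eq , _) =
              subst (λ j → edge j ∈ᶜ D) (sym (vertex-distinct eq)) b∈D
    ...     | inj₂ (eq , _) = contradiction
              (cong edge (sym (next-injective (vertex-distinct eq)))) b≢eᵢ

  -- Acyclic edge sets and the effect of one toggle.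

  Acyclic-⊆ : ∀ {X Y} → X ⊆ Y → Acyclic G Y → Acyclic G X
  Acyclic-⊆ X⊆Y acyclic (C , C⊆X) = acyclic (C , λ g → X⊆Y ∘ C⊆X g)

  -- A cycle inside `Y` would lie on `C`, hence use every edge of `C`, even the missing `h`.
  proper-subset-of-cycle-acyclic : ∀ (C : Cycle G) {Y h} →
    (∀ {g} → g ∈ Y → g ∈ᶜ C) → h ∈ᶜ C → h ∉ Y → Acyclic G Y
  proper-subset-of-cycle-acyclic C Y⊆C h∈C h∉Y (D , D⊆Y) =
    h∉Y (D⊆Y _ (cycle-⊆⇒⊇ C D (Y⊆C ∘ D⊆Y _) h∈C))

  -- The stored proof is irrelevant, but being a negation it only has to produce a contradiction,
  -- which may be eliminated irrelevantly.
  value-acyclic : ∀ (X : AcyclicSubgraph G) → Acyclic G (value X)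
  value-acyclic (X , [ p ]) c = ⊥-elim-irr (p c)

  -- Removing an edge creates no cycle, so removal always succeeds, and `e` is present afterwards
  -- only if it was just added.
  ∈-toggle-self : ∀ e X → e ∈ value (toggle G e X) ⇔
                          (e ∉ value X × Acyclic G (value X ∪ ⁅ e ⁆))
  ∈-toggle-self e (X , p) with e ∈? X
  ... | no  e∉X with acyclic? G (X ∪ ⁅ e ⁆)
  ...   | yes a  = mk⇔ (λ _ → e∉X , a) (λ _ → x∈p∪⁅x⁆)
  ...   | no  ¬a = mk⇔ (λ e∈X → contradiction e∈X e∉X) (λ (_ , a) → contradiction a ¬a)
  ∈-toggle-self e X̂@(X , p) | yes e∈X with acyclic? G (X - e)
  ...   | yes _  = mk⇔ (λ e∈ → contradiction e∈ (x∉p-x X e))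
                       (λ (e∉X , _) → contradiction e∈X e∉X)
  ...   | no  ¬a = contradiction (Acyclic-⊆ (p─q⊆p X ⁅ e ⁆) (value-acyclic X̂)) ¬a

  ∈-toggle-other : ∀ e X {g} → g ≢ e → g ∈ value (toggle G e X) ⇔ g ∈ value X
  ∈-toggle-other e (X , p) g≢e with e ∈? X
  ... | no  _ with acyclic? G (X ∪ ⁅ e ⁆)
  ...   | no  _ = mk⇔ (λ q → q) (λ q → q)
  ...   | yes _ = mk⇔ to′ (x∈p∪q⁺ ∘ inj₁)
    where
    to′ : _ ∈ X ∪ ⁅ e ⁆ → _ ∈ X
    to′ q with x∈p∪⁅y⁆⁻ X q
    ... | inj₁ g∈X = g∈X
    ... | inj₂ g≡e = contradiction g≡e g≢e
  ∈-toggle-other e (X , p) g≢e | yes _ with acyclic? G (X - e)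
  ...   | no  _ = mk⇔ (λ q → q) (λ q → q)
  ...   | yes _ = mk⇔ (p─q⊆p X ⁅ e ⁆) (λ g∈X → x∈p∧x≢y⇒x∈p-y g∈X g≢e)

  -- Commutation of toggles and common cycles.

  -- A cycle in Y ∪ {e} passes through e, hence avoids f, off which X and Y
  -- agree.
  addable-transfer : ∀ {e f} → ¬ (Σ[ C ∈ Cycle G ] (e ∈ᶜ C × f ∈ᶜ C)) →
    ∀ (X Y : AcyclicSubgraph G) →
    (∀ {g} → g ≢ f → g ∈ value Y → g ∈ value X) →
    Acyclic G (value X ∪ ⁅ e ⁆) → Acyclic G (value Y ∪ ⁅ e ⁆)
  addable-transfer {e} {f} no-cycle X Y Y⊆X acyclic (C , C⊆Y+e) with e ∈ᶜ? C
  ... | no e∉C = value-acyclic Y (C , C⊆Y)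
    where
    C⊆Y : ∀ g → g ∈ᶜ C → g ∈ value Y
    C⊆Y g g∈C with x∈p∪⁅y⁆⁻ (value Y) (C⊆Y+e g g∈C)
    ... | inj₁ g∈Y  = g∈Y
    ... | inj₂ refl = contradiction g∈C e∉C
  ... | yes e∈C = acyclic (C , C⊆X+e)
    where
    C⊆X+e : ∀ g → g ∈ᶜ C → g ∈ value X ∪ ⁅ e ⁆
    C⊆X+e g g∈C with x∈p∪⁅y⁆⁻ (value Y) (C⊆Y+e g g∈C)
    ... | inj₁ g∈Y  = x∈p∪q⁺ (inj₁ (Y⊆X (λ { refl → no-cycle (C , e∈C , g∈C) }) g∈Y))
    ... | inj₂ refl = x∈p∪⁅x⁆

  -- Both sides say that `e` is absent and addable, the left for `toggle G f X` and the right for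
  -- `X`. These sets differ at most in `f`, so `addable-transfer` applies in both directions.
  ∈-toggle-self-toggle : ∀ {e f} → e ≢ f →
    ¬ (Σ[ C ∈ Cycle G ] (e ∈ᶜ C × f ∈ᶜ C)) → ∀ X →
    e ∈ value (toggle G e (toggle G f X)) ⇔ e ∈ value (toggle G f (toggle G e X))
  ∈-toggle-self-toggle {e} {f} e≢f no-cycle X = mk⇔
    (λ e∈ → let e∉ , a = to (∈-toggle-self e fX) e∈ in
      from (∈-toggle-other f eX e≢f) (from (∈-toggle-self e X)
        ( e∉ ∘ from (∈-toggle-other f X e≢f)
        , addable-transfer no-cycle fX X (from ∘ ∈-toggle-other f X) a)))
    (λ e∈ → let e∉ , a = to (∈-toggle-self e X) (to (∈-toggle-other f eX e≢f) e∈) in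
      from (∈-toggle-self e fX)
        ( e∉ ∘ to (∈-toggle-other f X e≢f)
        , addable-transfer no-cycle X fX (to ∘ ∈-toggle-other f X) a))
    where
    eX = toggle G e X
    fX = toggle G f X

  no-common-cycle⇒toggles-commute : ∀ {e f} → e ≢ f →
    ¬ (Σ[ C ∈ Cycle G ] (e ∈ᶜ C × f ∈ᶜ C)) → ∀ X →
    toggle G e (toggle G f X) ≡ toggle G f (toggle G e X)
  no-common-cycle⇒toggles-commute {e} {f} e≢f no-cycle X =
    value-injective (⊆-pointwise-antisym same)
    where
    same : ∀ g → g ∈ value (toggle G e (toggle G f X)) ⇔
                 g ∈ value (toggle G f (toggle G e X))
    same g with g ≟ e | g ≟ f
    ... | yes refl | _ = ∈-toggle-self-toggle e≢f no-cycle X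
    -- With the roles of `e` and `f` exchanged, the two sides appear in the opposite order, so the
    -- directions are swapped.
    ... | no _ | yes refl = mk⇔ (from f-case) (to f-case)
      where
      f-case = ∈-toggle-self-toggle (e≢f ∘ sym)
                 (λ (C , f∈C , e∈C) → no-cycle (C , e∈C , f∈C)) X
    ... | no g≢e | no g≢f = mk⇔
          (from (∈-toggle-other f _ g≢f) ∘ from (∈-toggle-other e _ g≢e) ∘
            to (∈-toggle-other f _ g≢f) ∘ to (∈-toggle-other e _ g≢e))
          (from (∈-toggle-other e _ g≢e) ∘ from (∈-toggle-other f _ g≢f) ∘
            to (∈-toggle-other e _ g≢e) ∘ to (∈-toggle-other f _ g≢f))

  toggles-commute⇒no-common-cycle : ∀ {e f} → e ≢ f →
    (∀ X → toggle G e (toggle G f X) ≡ toggle G f (toggle G e X)) →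
    ¬ (Σ[ C ∈ Cycle G ] (e ∈ᶜ C × f ∈ᶜ C))
  toggles-commute⇒no-common-cycle {e} {f} e≢f commute (C , e∈C , f∈C) =
    -- Since `e` is present after the last toggle, it was addable to `toggle G f X̂`; but adding it
    -- completes `C`.
    proj₂ (to (∈-toggle-self e (toggle G f X̂)) e∈) (C , C⊆)
    where
    P? : Decidable (λ g → g ∈ᶜ C × g ≢ e × g ≢ f)
    P? g = (g ∈ᶜ? C) ×-dec ¬? (g ≟ e) ×-dec ¬? (g ≟ f)

    X : Subset #edges
    X = comprehension P?

    e∉X : e ∉ X
    e∉X q = proj₁ (proj₂ (to (∈-comprehension P?) q)) refl

    f∉X : f ∉ X
    f∉X q = proj₂ (proj₂ (to (∈-comprehension P?) q)) refl

    X⊆C : ∀ {g} → g ∈ X → g ∈ᶜ C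
    X⊆C = proj₁ ∘ to (∈-comprehension P?)

    -- Applied with `g` and `h` being `e` and `f` in either order: `h` is the edge of `C` still left
    -- out.
    X∪-acyclic : ∀ {g h} → g ∈ᶜ C → h ∈ᶜ C → h ∉ X → h ≢ g → Acyclic G (X ∪ ⁅ g ⁆)
    X∪-acyclic {g} {h} g∈C h∈C h∉X h≢g =
      proper-subset-of-cycle-acyclic C ⊆C h∈C h∉
      where
      ⊆C : ∀ {x} → x ∈ X ∪ ⁅ g ⁆ → x ∈ᶜ C
      ⊆C q with x∈p∪⁅y⁆⁻ X q
      ... | inj₁ x∈X  = X⊆C x∈X
      ... | inj₂ refl = g∈C
      h∉ : h ∉ X ∪ ⁅ g ⁆
      h∉ q with x∈p∪⁅y⁆⁻ X q
      ... | inj₁ h∈X = h∉X h∈X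
      ... | inj₂ h≡g = h≢g h≡g

    X̂ : AcyclicSubgraph G
    X̂ = X , [ proper-subset-of-cycle-acyclic C X⊆C e∈C e∉X ]

    f∈fX : f ∈ value (toggle G f X̂)
    f∈fX = from (∈-toggle-self f X̂) (f∉X , X∪-acyclic f∈C e∈C e∉X e≢f)

    e∈ : e ∈ value (toggle G e (toggle G f X̂))
    -- In the opposite order `e` is added to `X̂` first, and toggling `f` then leaves it in place;
    -- `commute` transports this.
    e∈ = subst (λ Y → e ∈ value Y) (sym (commute X̂))
           (from (∈-toggle-other f _ e≢f)
             (from (∈-toggle-self e X̂) (e∉X , X∪-acyclic e∈C f∈C f∉X (e≢f ∘ sym))))

    C⊆ : ∀ g → g ∈ᶜ C → g ∈ value (toggle G f X̂) ∪ ⁅ e ⁆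
    C⊆ g g∈C with g ≟ e | g ≟ f
    ... | yes refl | _        = x∈p∪⁅x⁆
    ... | no _     | yes refl = x∈p∪q⁺ (inj₁ f∈fX)
    ... | no g≢e   | no g≢f   = x∈p∪q⁺ (inj₁ (from (∈-toggle-other f X̂ g≢f)
                                  (from (∈-comprehension P?) (g∈C , g≢e , g≢f))))

-- Pairs of involutions.

module _ {a} {A : Set a} (s r : A → A)
         (s-involutive : ∀ x → s (s x) ≡ x) (r-involutive : ∀ x → r (r x) ≡ x) where

  -- `r ∘ s` is the inverse of `s ∘ r`, and a trivial square means that `s ∘ r` is its own inverse.
  square-trivial⇔involutions-commute :
    (∀ x → s (r (s (r x))) ≡ x) ⇔ (∀ x → s (r x) ≡ r (s x))
  square-trivial⇔involutions-commute = mk⇔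
    (λ square x → begin
      s (r x)                  ≡⟨ r-involutive (s (r x)) ⟨
      r (r (s (r x)))          ≡⟨ cong r (s-involutive (r (s (r x)))) ⟨
      r (s (s (r (s (r x)))))  ≡⟨ cong (r ∘ s) (square x) ⟩
      r (s x)                  ∎)
    (λ commute x → begin
      s (r (s (r x)))  ≡⟨ cong (s ∘ r) (commute x) ⟩
      s (r (r (s x)))  ≡⟨ cong s (r-involutive (s x)) ⟩
      s (s x)          ≡⟨ s-involutive x ⟩
      x                ∎)
    where open ≡-Reasoning

lemma3p29 : (G : Graph) (e f : Edge G) → e ≢ f →
    let open Group (ToggleGroup G) in
    ((t G e ∙ t G f) ∙ (t G e ∙ t G f) ≈ ε) ⇔
    (¬ (Σ[ C ∈ Cycle G ] (e ∈ᶜ C × f ∈ᶜ C)))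
lemma3p29 G e f e≢f = mk⇔
  (toggles-commute⇒no-common-cycle e≢f ∘ to square⇔commute)
  (from square⇔commute ∘ no-common-cycle⇒toggles-commute e≢f)
  where
  -- Equality in `ToggleGroup` is pointwise equality of the underlying maps, so the group equation
  -- unfolds to the one about `toggle G e` and `toggle G f`.
  square⇔commute = square-trivial⇔involutions-commute (toggle G e) (toggle G f)
                     (toggle-involutive G e) (toggle-involutive G f)
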